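{- Every c3dp-algebra is isomorphic to a contract algebra; that is, for every c3dp-algebra $\mathbf{A}$ there is a Boolean algebra $\mathbf{B}$ such that $\mathbf{A}$ is isomorphic (as a c3dp-algebra) to the contract algebra $\mathbf{C(B)}$ on $\mathbf{B}$.
   Context: A dp-algebra (double p-algebra) is an algebra $(A;\wedge,\vee,\neg,D,0,1)$ of type $(2,2,1,1,0,0)$ such that $(A;\wedge,\vee,0,1)$ is a bounded distributive lattice; for every $a\in A$, $\neg a$ is the greatest $b\in A$ with $a\wedge b=0$; and for every $a\in A$, $Da$ is the smallest $b\in A$ with $a\vee b=1$. It is regular if $a\wedge Da\le b\vee\neg b$ for all $a,b\in A$. A three-valued dp-algebra is a regular dp-algebra satisfying $\neg x\vee\neg\neg x=1$ and $Dx\wedge DDx=0$. A c3dp-algebra (centred three-valued dp-algebra) is an algebra $(A;\wedge,\vee,\neg,D,0,c,1)$ such that $(A;\wedge,\vee,\neg,D,0,1)$ is a three-valued dp-algebra and the constant $c$ satisfies $\neg c=0$ and $Dc=1$. For a Boolean algebra $\mathbf{B} = (B;\cap,\cup,',0,1)$, the contract algebra on $\mathbf{B}$ is $\mathbf{C(B)} = (C(B);\wedge,\vee,\neg,D,\bot,\gamma,\top)$ with universe $C(B) = \{(a,b) \in B\times B : a \cup b = 1\}$ and operations $(a,b)\wedge(c,d) = (a\cup c, b\cap d)$, $(a,b)\vee(c,d) = (a\cap c, b\cup d)$, $\neg(a,b) = (b,b')$, $D(a,b) = (a',a)$, $\bot = (1,0)$, $\gamma = (1,1)$, $\top=(0,1)$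 (with $\bot,\gamma,\top$ interpreting $0,c,1$). -}

module Defs where

open import Algebra.Core using (Op₁; Op₂)
open import Algebra.Lattice.Bundles using (BooleanAlgebra; RawLattice)
open import Algebra.Lattice.Morphism.Structures using (IsLatticeIsomorphism)
import Algebra.Definitions as Definitions
import Algebra.Lattice.Properties.BooleanAlgebra as BooleanAlgebraProperties
import Algebra.Lattice.Structures as LatticeStructures
import Algebra.Morphism.Definitions as MorphismDefinitions
open import Data.Product using (_×_; _,_; proj₁; proj₂; Σ-syntax; ∃-syntax)
open import Level using (_⊔_; suc)
open import Relation.Binary.Core using (Rel)
import Relation.Binary.Construct.NaturalOrder.Left as LeftNaturalOrder
import Relation.Binary.Reasoning.Setoid as SetoidReasoning

-- Algebras are setoid-based, as in Algebra.Lattice: the equality of an algebra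
-- is its relation _≈_.  0 = 1 is not excluded.

module _ {a ℓ} {A : Set a} (_≈_ : Rel A ℓ) where

  open Definitions _≈_ using (Identity)
  open LatticeStructures _≈_ using (IsDistributiveLattice)

  -- The order is the lattice order: x ≤ y means x ≈ x ∧ y.  Congruence of ¬ and
  -- D is not assumed, since it follows from their extremal characterizations.

  record IsDpAlgebra (_∧_ _∨_ : Op₂ A) (¬ D : Op₁ A) (0# 1# : A) : Set (a ⊔ ℓ) where
    open LeftNaturalOrder _≈_ _∧_ public using (_≤_)
    field
      isDistributiveLattice : IsDistributiveLattice _∨_ _∧_
      ∨-identity            : Identity 0# _∨_
      ∧-identity            : Identity 1# _∧_
      ¬-disjoint            : ∀ x → (x ∧ ¬ x) ≈ 0#
      ¬-greatest            : ∀ x y → (x ∧ y) ≈ 0# → y ≤ ¬ x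
      D-covers              : ∀ x → (x ∨ D x) ≈ 1#
      D-least               : ∀ x y → (x ∨ y) ≈ 1# → D x ≤ y

    open IsDistributiveLattice isDistributiveLattice public

  record IsRegularDpAlgebra (_∧_ _∨_ : Op₂ A) (¬ D : Op₁ A) (0# 1# : A) : Set (a ⊔ ℓ) where
    field
      isDpAlgebra : IsDpAlgebra _∧_ _∨_ ¬ D 0# 1#

    open IsDpAlgebra isDpAlgebra public

    field
      regular : ∀ x y → (x ∧ D x) ≤ (y ∨ ¬ y)

  record IsThreeValuedDpAlgebra (_∧_ _∨_ : Op₂ A) (¬ D : Op₁ A) (0# 1# : A) : Set (a ⊔ ℓ) where
    field
      isRegularDpAlgebra : IsRegularDpAlgebra _∧_ _∨_ ¬ D 0# 1#
      stone              : ∀ x → (¬ x ∨ ¬ (¬ x)) ≈ 1#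
      dualStone          : ∀ x → (D x ∧ D (D x)) ≈ 0#

    open IsRegularDpAlgebra isRegularDpAlgebra public

  record IsC3dpAlgebra (_∧_ _∨_ : Op₂ A) (¬ D : Op₁ A) (0# c 1# : A) : Set (a ⊔ ℓ) where
    field
      isThreeValuedDpAlgebra : IsThreeValuedDpAlgebra _∧_ _∨_ ¬ D 0# 1#
      ¬-centre               : ¬ c ≈ 0#
      D-centre               : D c ≈ 1#

    open IsThreeValuedDpAlgebra isThreeValuedDpAlgebra public

record RawC3dpAlgebra a ℓ : Set (suc (a ⊔ ℓ)) where
  infix  8 ¬_
  infixr 7 _∧_
  infixr 6 _∨_
  infix  4 _≈_
  field
    Carrier : Set a
    _≈_     : Rel Carrier ℓ
    _∧_     : Op₂ Carrier
    _∨_     : Op₂ Carrier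
    ¬_      : Op₁ Carrier
    D       : Op₁ Carrier
    0#      : Carrier
    c       : Carrier
    1#      : Carrier

  rawLattice : RawLattice a ℓ
  rawLattice = record { _≈_ = _≈_ ; _∧_ = _∧_ ; _∨_ = _∨_ }

record C3dpAlgebra a ℓ : Set (suc (a ⊔ ℓ)) where
  field
    rawC3dpAlgebra : RawC3dpAlgebra a ℓ

  open RawC3dpAlgebra rawC3dpAlgebra public

  field
    isC3dpAlgebra : IsC3dpAlgebra _≈_ _∧_ _∨_ ¬_ D 0# c 1#

  open IsC3dpAlgebra isC3dpAlgebra public

module _ {a b ℓ₁ ℓ₂} (𝐀 : RawC3dpAlgebra a ℓ₁) (𝐁 : RawC3dpAlgebra b ℓ₂) where

  private
    module A = RawC3dpAlgebra 𝐀
    module B = RawC3dpAlgebra 𝐁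

  open MorphismDefinitions A.Carrier B.Carrier B._≈_

  record IsC3dpIsomorphism (⟦_⟧ : A.Carrier → B.Carrier) : Set (a ⊔ b ⊔ ℓ₁ ⊔ ℓ₂) where
    field
      isLatticeIsomorphism : IsLatticeIsomorphism A.rawLattice B.rawLattice ⟦_⟧
      ¬-homo               : Homomorphic₁ ⟦_⟧ A.¬_ B.¬_
      D-homo               : Homomorphic₁ ⟦_⟧ A.D B.D
      0#-homo              : Homomorphic₀ ⟦_⟧ A.0# B.0#
      c-homo               : Homomorphic₀ ⟦_⟧ A.c B.c
      1#-homo              : Homomorphic₀ ⟦_⟧ A.1# B.1#

    open IsLatticeIsomorphism isLatticeIsomorphism public

  _≅_ : Set (a ⊔ b ⊔ ℓ₁ ⊔ ℓ₂)
  _≅_ = ∃[ f ] IsC3dpIsomorphism f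

module _ {b ℓ} (𝐁 : BooleanAlgebra b ℓ) where

  private
    module B = BooleanAlgebra 𝐁
  open BooleanAlgebraProperties 𝐁 using (∨-zeroˡ; ∨-zeroʳ; ∧-idem)
  open SetoidReasoning B.setoid

  Contract : Set (b ⊔ ℓ)
  Contract = Σ[ p ∈ B.Carrier × B.Carrier ] (proj₁ p B.∨ proj₂ p) B.≈ B.⊤

  private
    variable
      x y z w : B.Carrier

    closed-∧ : (x B.∨ y) B.≈ B.⊤ → (z B.∨ w) B.≈ B.⊤ →
               ((x B.∨ z) B.∨ (y B.∧ w)) B.≈ B.⊤
    closed-∧ {x} {y} {z} {w} p q = begin
      (x B.∨ z) B.∨ (y B.∧ w)                        ≈⟨ B.∨-distribˡ-∧ _ _ _ ⟩
      ((x B.∨ z) B.∨ y) B.∧ ((x B.∨ z) B.∨ w)        ≈⟨ B.∧-congʳ (B.∨-congʳ (B.∨-comm x z)) ⟩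
      ((z B.∨ x) B.∨ y) B.∧ ((x B.∨ z) B.∨ w)        ≈⟨ B.∧-cong (B.∨-assoc z x y) (B.∨-assoc x z w) ⟩
      (z B.∨ (x B.∨ y)) B.∧ (x B.∨ (z B.∨ w))        ≈⟨ B.∧-cong (B.∨-congˡ p) (B.∨-congˡ q) ⟩
      (z B.∨ B.⊤) B.∧ (x B.∨ B.⊤)                    ≈⟨ B.∧-cong (∨-zeroʳ z) (∨-zeroʳ x) ⟩
      B.⊤ B.∧ B.⊤                                    ≈⟨ ∧-idem B.⊤ ⟩
      B.⊤                                            ∎

    closed-∨ : (x B.∨ y) B.≈ B.⊤ → (z B.∨ w) B.≈ B.⊤ →
               ((x B.∧ z) B.∨ (y B.∨ w)) B.≈ B.⊤
    closed-∨ p q = B.trans (B.∨-comm _ _)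
      (closed-∧ (B.trans (B.∨-comm _ _) p) (B.trans (B.∨-comm _ _) q))

  contractAlgebra : RawC3dpAlgebra (b ⊔ ℓ) ℓ
  contractAlgebra = record
    { Carrier = Contract
    ; _≈_     = λ { ((x , y) , _) ((z , w) , _) → (x B.≈ z) × (y B.≈ w) }
    ; _∧_     = λ { ((x , y) , p) ((z , w) , q) → ((x B.∨ z) , (y B.∧ w)) , closed-∧ p q }
    ; _∨_     = λ { ((x , y) , p) ((z , w) , q) → ((x B.∧ z) , (y B.∨ w)) , closed-∨ p q }
    ; ¬_      = λ { ((x , y) , _) → (y , B.¬ y) , B.∨-complementʳ y }
    ; D       = λ { ((x , y) , _) → (B.¬ x , x) , B.∨-complementˡ x }
    ; 0#      = (B.⊤ , B.⊥) , ∨-zeroˡ B.⊥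
    ; c       = (B.⊤ , B.⊤) , ∨-zeroˡ B.⊤
    ; 1#      = (B.⊥ , B.⊤) , ∨-zeroʳ B.⊥
    }

{-# OPTIONS --safe #-}

-- In a double Stone algebra the skeleton ¬A is the Boolean algebra of
-- complemented elements, and x ↦ ¬ ¬ x is a lattice homomorphism onto it, so 𝐁
-- can be taken to be A modulo the kernel of ¬.  In 𝐂(𝐁), the second coordinates
-- of p and D p are the two coordinates of p in reverse order, which forces the
-- isomorphism to be x ↦ (D x , x).  It is injective because, by regularity, an
-- element is determined by ¬ x and D x; and (a , b) is the image of
-- ¬ a ∨ (c ∧ ¬ ¬ b), since meeting with the centre keeps ¬ and makes D trivial.
module Submission where

open import Defs
open import Algebra.Core using (Op₁; Op₂)
open import Algebra.Lattice.Bundles using (BooleanAlgebra; DistributiveLattice)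
import Algebra.Lattice.Properties.DistributiveLattice as DistributiveLatticeProperties
open import Algebra.Lattice.Structures.Biased using (isBooleanAlgebraʳ)
open import Data.Product using (Σ-syntax; _,_; proj₁; proj₂)
open import Function.Base using (_on_)
open import Level using (_⊔_; suc)
open import Relation.Binary.Core using (Rel)
import Relation.Binary.Construct.On as On
import Relation.Binary.Lattice as OrderTheoretic
import Relation.Binary.Reasoning.PartialOrder as PosetReasoning
import Relation.Binary.Reasoning.Setoid as SetoidReasoning

-- Double Stone algebras and order duality.

record DoubleStoneAlgebra a ℓ : Set (suc (a ⊔ ℓ)) where
  infix  8 ¬_
  infixr 7 _∧_
  infixr 6 _∨_
  infix  4 _≈_
  field
    Carrier     : Set a
    _≈_         : Rel Carrier ℓ
    _∧_         : Op₂ Carrier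
    _∨_         : Op₂ Carrier
    ¬_          : Op₁ Carrier
    D           : Op₁ Carrier
    0#          : Carrier
    1#          : Carrier
    isDpAlgebra : IsDpAlgebra _≈_ _∧_ _∨_ ¬_ D 0# 1#
    stone       : ∀ x → ¬ x ∨ ¬ ¬ x ≈ 1#
    dualStone   : ∀ x → D x ∧ D (D x) ≈ 0#

  open IsDpAlgebra isDpAlgebra public

  distributiveLattice : DistributiveLattice a ℓ
  distributiveLattice = record { isDistributiveLattice = isDistributiveLattice }

  open DistributiveLatticeProperties distributiveLattice public
    using (poset; ∧-∨-isDistributiveLattice; ∨-∧-orderTheoreticLattice)
  open OrderTheoretic.Lattice ∨-∧-orderTheoreticLattice public
    using (antisym; x∧y≤x; x∧y≤y; ∧-greatest; x≤x∨y; y≤x∨y; ∨-least)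
    renaming (refl to ≤-refl; reflexive to ≤-reflexive; trans to ≤-trans)
  open DistributiveLattice distributiveLattice public using (setoid)

module _ {a ℓ} (S : DoubleStoneAlgebra a ℓ) where

  open DoubleStoneAlgebra S

  private
    -- In the dual algebra `_≤_` unfolds to an equation between joins; this turns an inequality into
    -- the reversed one there.
    ≤⇒∨≈ : ∀ {x y} → x ≤ y → y ≈ y ∨ x
    ≤⇒∨≈ x≤y = antisym (x≤x∨y _ _) (∨-least ≤-refl x≤y)

  -- Reversing the order exchanges `¬` with `D` and `0#` with `1#`, so every law proved for `¬`
  -- yields a law for `D`.
  dual : DoubleStoneAlgebra a ℓ
  dual = record
    { isDpAlgebra = record
      { isDistributiveLattice = ∧-∨-isDistributiveLattice
      ; ∨-identity            = ∧-identity
      ; ∧-identity            = ∨-identity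
      ; ¬-disjoint            = D-covers
      ; ¬-greatest            = λ x y x∨y≈1 → ≤⇒∨≈ (D-least x y x∨y≈1)
      ; D-covers              = ¬-disjoint
      ; D-least               = λ x y x∧y≈0 → ≤⇒∨≈ (¬-greatest x y x∧y≈0)
      }
    ; stone     = dualStone
    ; dualStone = stone
    }

-- Laws of the pseudocomplement.

module PseudocomplementProperties {a ℓ} (S : DoubleStoneAlgebra a ℓ) where

  open DoubleStoneAlgebra S

  private
    variable
      x y z : Carrier

  0≤ : ∀ x → 0# ≤ x
  0≤ x = ≤-trans (x≤x∨y 0# x) (≤-reflexive (proj₁ ∨-identity x))

  ≤0⇒≈0 : x ≤ 0# → x ≈ 0#
  ≤0⇒≈0 x≤0 = antisym x≤0 (0≤ _)

  ≤1 : ∀ x → x ≤ 1#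
  ≤1 x = sym (proj₂ ∧-identity x)

  ∧-zeroˡ : ∀ x → 0# ∧ x ≈ 0#
  ∧-zeroˡ x = ≤0⇒≈0 (x∧y≤x 0# x)

  ∨-zeroˡ : ∀ x → 1# ∨ x ≈ 1#
  ∨-zeroˡ x = antisym (≤1 _) (x≤x∨y 1# x)

  ≤⇒disjoint-¬ : x ≤ y → x ∧ ¬ y ≈ 0#
  ≤⇒disjoint-¬ {x} {y} x≤y = ≤0⇒≈0 (≤-trans
    (∧-greatest (≤-trans (x∧y≤x x (¬ y)) x≤y) (x∧y≤y x (¬ y)))
    (≤-reflexive (¬-disjoint y)))

  ¬-antitone : x ≤ y → ¬ y ≤ ¬ x
  ¬-antitone x≤y = ¬-greatest _ _ (≤⇒disjoint-¬ x≤y)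

  ¬-cong : x ≈ y → ¬ x ≈ ¬ y
  ¬-cong x≈y = antisym (¬-antitone (≤-reflexive (sym x≈y))) (¬-antitone (≤-reflexive x≈y))

  ¬-0 : ¬ 0# ≈ 1#
  ¬-0 = antisym (≤1 _) (¬-greatest 0# 1# (∧-zeroˡ 1#))

  ¬-1 : ¬ 1# ≈ 0#
  ¬-1 = trans (sym (proj₁ ∧-identity (¬ 1#))) (¬-disjoint 1#)

  -- By distributivity `z` splits into its parts under `x` and under `y`, and the first part
  -- vanishes.
  ∨≈1⇒≤-by-disjoint : x ∨ y ≈ 1# → x ∧ z ≈ 0# → z ≤ y
  ∨≈1⇒≤-by-disjoint {x} {y} {z} x∨y≈1 x∧z≈0 = begin
    z                  ≈⟨ proj₁ ∧-identity z ⟨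
    1# ∧ z             ≈⟨ ∧-congʳ x∨y≈1 ⟨
    (x ∨ y) ∧ z        ≈⟨ ∧-distribʳ-∨ z x y ⟩
    (x ∧ z) ∨ (y ∧ z)  ≈⟨ ∨-congʳ x∧z≈0 ⟩
    0# ∨ (y ∧ z)       ≈⟨ proj₁ ∨-identity (y ∧ z) ⟩
    y ∧ z              ≤⟨ x∧y≤x y z ⟩
    y                  ∎
    where open PosetReasoning poset

  ¬-complement : x ∧ y ≈ 0# → x ∨ y ≈ 1# → ¬ x ≈ y
  ¬-complement {x} {y} x∧y≈0 x∨y≈1 =
    antisym (∨≈1⇒≤-by-disjoint x∨y≈1 (¬-disjoint x)) (¬-greatest x y x∧y≈0)

  -- By `stone`, `¬ x` is a complement of `¬ ¬ x`.
  ¬¬¬ : ∀ x → ¬ ¬ ¬ x ≈ ¬ x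
  ¬¬¬ x = ¬-complement
    (trans (∧-comm _ _) (¬-disjoint (¬ x)))
    (trans (∨-comm _ _) (stone x))

  ¬-∨ : ∀ x y → ¬ (x ∨ y) ≈ ¬ x ∧ ¬ y
  ¬-∨ x y = antisym
    (∧-greatest (¬-antitone (x≤x∨y x y)) (¬-antitone (y≤x∨y x y)))
    (¬-greatest (x ∨ y) (¬ x ∧ ¬ y) (begin
      (x ∨ y) ∧ (¬ x ∧ ¬ y)                  ≈⟨ ∧-distribʳ-∨ _ x y ⟩
      (x ∧ (¬ x ∧ ¬ y)) ∨ (y ∧ (¬ x ∧ ¬ y))  ≈⟨ ∨-cong (∧-assoc x _ _) (∧-congˡ (∧-comm _ _)) ⟨
      ((x ∧ ¬ x) ∧ ¬ y) ∨ (y ∧ (¬ y ∧ ¬ x))  ≈⟨ ∨-congˡ (∧-assoc y _ _) ⟨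
      ((x ∧ ¬ x) ∧ ¬ y) ∨ ((y ∧ ¬ y) ∧ ¬ x)  ≈⟨ ∨-cong (∧-congʳ (¬-disjoint x)) (∧-congʳ (¬-disjoint y)) ⟩
      (0# ∧ ¬ y) ∨ (0# ∧ ¬ x)                ≈⟨ ∨-cong (∧-zeroˡ _) (∧-zeroˡ _) ⟩
      0# ∨ 0#                                ≈⟨ proj₁ ∨-identity 0# ⟩
      0#                                     ∎))
    where open SetoidReasoning setoid

  -- This De Morgan law rests on `stone`, which splits `w` along `¬ y` and `¬ ¬ y`. Since `x ∧ w`
  -- lies below `¬ y`, the part under `¬ ¬ y` is disjoint from `x`.
  ¬-∧ : ∀ x y → ¬ (x ∧ y) ≈ ¬ x ∨ ¬ y
  ¬-∧ x y = antisym
    (begin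
      w                        ≈⟨ proj₂ ∧-identity w ⟨
      w ∧ 1#                   ≈⟨ ∧-congˡ (stone y) ⟨
      w ∧ (¬ y ∨ ¬ ¬ y)        ≈⟨ ∧-distribˡ-∨ w _ _ ⟩
      (w ∧ ¬ y) ∨ (w ∧ ¬ ¬ y)  ≤⟨ ∨-least
                                    (≤-trans (x∧y≤y _ _) (y≤x∨y _ _))
                                    (≤-trans w∧¬¬y≤¬x (x≤x∨y _ _)) ⟩
      ¬ x ∨ ¬ y                ∎)
    (∨-least (¬-antitone (x∧y≤x x y)) (¬-antitone (x∧y≤y x y)))
    where
    open PosetReasoning poset
    w = ¬ (x ∧ y)

    x∧w≤¬y : x ∧ w ≤ ¬ y
    x∧w≤¬y = ¬-greatest y (x ∧ w)
      (trans (sym (∧-assoc y x w)) (trans (∧-congʳ (∧-comm y x)) (¬-disjoint (x ∧ y))))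

    w∧¬¬y≤¬x : w ∧ ¬ ¬ y ≤ ¬ x
    w∧¬¬y≤¬x = ¬-greatest x (w ∧ ¬ ¬ y)
      (trans (sym (∧-assoc x w (¬ ¬ y))) (≤⇒disjoint-¬ x∧w≤¬y))

-- Interaction of `¬` and `D`, and the Boolean skeleton.

module DoubleStoneProperties {a ℓ} (S : DoubleStoneAlgebra a ℓ) where

  open DoubleStoneAlgebra S
  open PseudocomplementProperties S public
  open PseudocomplementProperties (dual S) public
    using ()
    renaming
    ( ¬-cong       to D-cong
    ; ¬-0          to D-1
    ; ¬-1          to D-0
    ; ¬-∨          to D-∧
    ; ¬-∧          to D-∨
    ; ¬-complement to D-complement
    ; ¬¬¬          to DDD
    )

  -- `¬ x` and `¬ ¬ x` are complements, and `D` sends a complemented element to its complement.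
  D¬≈¬¬ : ∀ x → D (¬ x) ≈ ¬ ¬ x
  D¬≈¬¬ x = D-complement (stone x) (¬-disjoint (¬ x))

  ¬D≈DD : ∀ x → ¬ D x ≈ D (D x)
  ¬D≈DD x = ¬-complement (dualStone x) (D-covers (D x))

  -- On values of `D` the two negations agree, so one more `D` recovers `D x`. This lifts equality
  -- of first coordinates from the skeleton to the algebra.
  ¬D-injective : ∀ {x y} → ¬ D x ≈ ¬ D y → D x ≈ D y
  ¬D-injective {x} {y} ¬Dx≈¬Dy = begin
    D x          ≈⟨ DDD x ⟨
    D (D (D x))  ≈⟨ D-cong (¬D≈DD x) ⟨
    D (¬ D x)    ≈⟨ D-cong ¬Dx≈¬Dy ⟩
    D (¬ D y)    ≈⟨ D-cong (¬D≈DD y) ⟩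
    D (D (D y))  ≈⟨ DDD y ⟩
    D y          ∎
    where open SetoidReasoning setoid

  -- The carrier is kept and only the equality is coarsened: the subset of
  -- closed elements {x | ¬ ¬ x ≈ x} would land in the universe a ⊔ ℓ.
  skeleton : BooleanAlgebra a ℓ
  skeleton = record
    { _≈_              = _≈_ on ¬_
    ; _∨_              = _∨_
    ; _∧_              = _∧_
    ; ¬_               = ¬_
    ; ⊤                = 1#
    ; ⊥                = 0#
    ; isBooleanAlgebra = isBooleanAlgebraʳ record
      { isDistributiveLattice = record
        { isLattice   = record
          { isEquivalence = On.isEquivalence ¬_ isEquivalence
          ; ∨-comm        = λ x y → ¬-cong (∨-comm x y)
          ; ∨-assoc       = λ x y z → ¬-cong (∨-assoc x y z)
          ; ∨-cong        = λ p q → trans (¬-∨ _ _) (trans (∧-cong p q) (sym (¬-∨ _ _)))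
          ; ∧-comm        = λ x y → ¬-cong (∧-comm x y)
          ; ∧-assoc       = λ x y z → ¬-cong (∧-assoc x y z)
          ; ∧-cong        = λ p q → trans (¬-∧ _ _) (trans (∨-cong p q) (sym (¬-∧ _ _)))
          ; absorptive    = (λ x y → ¬-cong (∨-absorbs-∧ x y))
                          , (λ x y → ¬-cong (∧-absorbs-∨ x y))
          }
        ; ∨-distrib-∧ = (λ x y z → ¬-cong (∨-distribˡ-∧ x y z))
                      , (λ x y z → ¬-cong (∨-distribʳ-∧ x y z))
        ; ∧-distrib-∨ = (λ x y z → ¬-cong (∧-distribˡ-∨ x y z))
                      , (λ x y z → ¬-cong (∧-distribʳ-∨ x y z))
        }
      -- `x ∨ ¬ x` is dense: its pseudocomplement is `0#`, like that of the top.
      ; ∨-complementʳ = λ x → trans (¬-∨ x (¬ x)) (trans (¬-disjoint (¬ x)) (sym ¬-1))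
      ; ∧-complementʳ = λ x → ¬-cong (¬-disjoint x)
      ; ¬-cong        = ¬-cong
      }
    }

-- The isomorphism with the contract algebra on the skeleton.

module Representation {a ℓ} (𝐀 : C3dpAlgebra a ℓ) where

  open C3dpAlgebra 𝐀 using (c; ¬-centre; D-centre; regular; rawC3dpAlgebra)

  doubleStone : DoubleStoneAlgebra a ℓ
  doubleStone = record
    { isDpAlgebra = C3dpAlgebra.isDpAlgebra 𝐀
    ; stone       = C3dpAlgebra.stone 𝐀
    ; dualStone   = C3dpAlgebra.dualStone 𝐀
    }

  open DoubleStoneAlgebra doubleStone
  open DoubleStoneProperties doubleStone

  private
    module C = RawC3dpAlgebra (contractAlgebra skeleton)

  -- `y` and `D y` cover `x`, and the part under `D y` is `x ∧ D x`. Regularity puts that part below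
  -- `y ∨ ¬ y`, where `¬ y`, being `¬ x`, is disjoint from `x`.
  ¬≈⇒D≈⇒≤ : ∀ {x y} → ¬ x ≈ ¬ y → D x ≈ D y → x ≤ y
  ¬≈⇒D≈⇒≤ {x} {y} ¬x≈¬y Dx≈Dy = begin
    x                          ≈⟨ proj₂ ∧-identity x ⟨
    x ∧ 1#                     ≈⟨ ∧-congˡ (D-covers y) ⟨
    x ∧ (y ∨ D y)              ≈⟨ ∧-distribˡ-∨ x y (D y) ⟩
    (x ∧ y) ∨ (x ∧ D y)        ≈⟨ ∨-congˡ (∧-congˡ Dx≈Dy) ⟨
    (x ∧ y) ∨ (x ∧ D x)        ≤⟨ ∨-least (x∧y≤y x y) x∧Dx≤y ⟩
    y                          ∎
    where
    open PosetReasoning poset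

    x∧Dx≤y : x ∧ D x ≤ y
    x∧Dx≤y = begin
      x ∧ D x              ≤⟨ ∧-greatest (x∧y≤x x (D x)) (regular x y) ⟩
      x ∧ (y ∨ ¬ y)        ≈⟨ ∧-distribˡ-∨ x y (¬ y) ⟩
      (x ∧ y) ∨ (x ∧ ¬ y)  ≈⟨ ∨-congˡ (∧-congˡ ¬x≈¬y) ⟨
      (x ∧ y) ∨ (x ∧ ¬ x)  ≈⟨ ∨-congˡ (¬-disjoint x) ⟩
      (x ∧ y) ∨ 0#         ≈⟨ proj₂ ∨-identity (x ∧ y) ⟩
      x ∧ y                ≤⟨ x∧y≤y x y ⟩
      y                    ∎

  ¬-D-jointlyInjective : ∀ {x y} → ¬ x ≈ ¬ y → D x ≈ D y → x ≈ y
  ¬-D-jointlyInjective ¬x≈¬y Dx≈Dy =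
    antisym (¬≈⇒D≈⇒≤ ¬x≈¬y Dx≈Dy) (¬≈⇒D≈⇒≤ (sym ¬x≈¬y) (sym Dx≈Dy))

  toContract : Carrier → C.Carrier
  toContract x = (D x , x) , ¬-cong (trans (∨-comm (D x) x) (D-covers x))

  fromContract : C.Carrier → Carrier
  fromContract ((x , y) , _) = ¬ x ∨ (c ∧ ¬ ¬ y)

  toContract-cong : ∀ {x y} → x ≈ y → toContract x C.≈ toContract y
  toContract-cong x≈y = ¬-cong (D-cong x≈y) , ¬-cong x≈y

  D-fromContract : ∀ p → D (fromContract p) ≈ ¬ ¬ proj₁ (proj₁ p)
  D-fromContract ((x , y) , _) = begin
    D (¬ x ∨ (c ∧ ¬ ¬ y))          ≈⟨ D-∨ (¬ x) (c ∧ ¬ ¬ y) ⟩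
    D (¬ x) ∧ D (c ∧ ¬ ¬ y)        ≈⟨ ∧-cong (D¬≈¬¬ x) (D-∧ c (¬ ¬ y)) ⟩
    ¬ ¬ x ∧ (D c ∨ D (¬ ¬ y))      ≈⟨ ∧-congˡ (∨-congʳ D-centre) ⟩
    ¬ ¬ x ∧ (1# ∨ D (¬ ¬ y))       ≈⟨ ∧-congˡ (∨-zeroˡ (D (¬ ¬ y))) ⟩
    ¬ ¬ x ∧ 1#                     ≈⟨ proj₂ ∧-identity (¬ ¬ x) ⟩
    ¬ ¬ x                          ∎
    where open SetoidReasoning setoid

  ¬-fromContract : ∀ p → ¬ fromContract p ≈ ¬ proj₂ (proj₁ p)
  ¬-fromContract ((x , y) , x∨y≈1) = begin
    ¬ (¬ x ∨ (c ∧ ¬ ¬ y))        ≈⟨ ¬-∨ (¬ x) (c ∧ ¬ ¬ y) ⟩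
    ¬ ¬ x ∧ ¬ (c ∧ ¬ ¬ y)        ≈⟨ ∧-congˡ (¬-∧ c (¬ ¬ y)) ⟩
    ¬ ¬ x ∧ (¬ c ∨ ¬ ¬ ¬ y)      ≈⟨ ∧-congˡ (∨-cong ¬-centre (¬¬¬ y)) ⟩
    ¬ ¬ x ∧ (0# ∨ ¬ y)           ≈⟨ ∧-congˡ (proj₁ ∨-identity (¬ y)) ⟩
    ¬ ¬ x ∧ ¬ y                  ≈⟨ ∧-comm (¬ ¬ x) (¬ y) ⟩
    -- The inequality `¬ y ≤ ¬ ¬ x` is by definition `¬ y ≈ ¬ y ∧ ¬ ¬ x`.
    ¬ y ∧ ¬ ¬ x                  ≈⟨ ¬-greatest (¬ x) (¬ y) ¬x∧¬y≈0 ⟨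
    ¬ y                          ∎
    where
    open SetoidReasoning setoid

    -- The contract condition is an equation of the skeleton, so it reads `¬ (x ∨ y) ≈ ¬ 1#`.
    ¬x∧¬y≈0 : ¬ x ∧ ¬ y ≈ 0#
    ¬x∧¬y≈0 = trans (sym (¬-∨ x y)) (trans x∨y≈1 ¬-1)

  toContract-fromContract : ∀ p → toContract (fromContract p) C.≈ p
  toContract-fromContract p =
    trans (¬-cong (D-fromContract p)) (¬¬¬ (proj₁ (proj₁ p))) , ¬-fromContract p

  toContract-isIsomorphism :
    IsC3dpIsomorphism rawC3dpAlgebra (contractAlgebra skeleton) toContract
  toContract-isIsomorphism = record
    { isLatticeIsomorphism = record
      { isLatticeMonomorphism = record
        { isLatticeHomomorphism = record
          { isRelHomomorphism = record { cong = toContract-cong }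
          ; ∧-homo            = λ x y → ¬-cong (D-∧ x y) , refl
          ; ∨-homo            = λ x y → ¬-cong (D-∨ x y) , refl
          }
        ; injective = λ (¬Dx≈¬Dy , ¬x≈¬y) →
            ¬-D-jointlyInjective ¬x≈¬y (¬D-injective ¬Dx≈¬Dy)
        }
      ; surjective = λ p → fromContract p , λ z≈x →
          let ¬D≈ , ¬≈ = toContract-cong z≈x
              ¬D≈′ , ¬≈′ = toContract-fromContract p
          in trans ¬D≈ ¬D≈′ , trans ¬≈ ¬≈′
      }
    -- In first coordinates, `D (¬ x)` must represent the same skeleton element as `x`.
    ; ¬-homo  = λ x → trans (¬-cong (D¬≈¬¬ x)) (¬¬¬ x) , refl
    ; D-homo  = λ x → ¬-cong (sym (¬D≈DD x)) , refl
    ; 0#-homo = ¬-cong D-0 , refl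
    -- `c` is dense, so it represents the top of the skeleton.
    ; c-homo  = ¬-cong D-centre , trans ¬-centre (sym ¬-1)
    ; 1#-homo = ¬-cong D-1 , refl
    }

corollary4p2 : ∀ {a ℓ} (𝐀 : C3dpAlgebra a ℓ) →
    Σ[ 𝐁 ∈ BooleanAlgebra a ℓ ] (C3dpAlgebra.rawC3dpAlgebra 𝐀 ≅ contractAlgebra 𝐁)
corollary4p2 𝐀 = skeleton , toContract , toContract-isIsomorphism
  where
  open Representation 𝐀
  open DoubleStoneProperties doubleStone using (skeleton)
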